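{- Let $n,k\ge 1$ be integers with $k\mid n$. Among all bipartite graphs $G=(X\cup Y,E)$ with $|X|=|Y|=n$ in which every vertex of $X$ has exactly $k$ neighbors in $Y$, the number of perfect matchings is highest for the graph $H$ that is the disjoint union of $n/k$ complete bipartite graphs $K_{k,k}$. That is, $\mathcal{M}(G)\le \mathcal{M}(H)$ for every such $G$.
   Context: Graphs are simple. A bipartite graph $G=(X\cup Y,E)$ has vertex bipartition $X,Y$ with $|X|=|Y|=n$; $X$ is the set of users and $Y$ the set of behaviors. A perfect matching is a set of $n$ edges such that every vertex is incident to exactly one of them. $\mathcal{M}(G)$ denotes the number of perfect matchings of $G$. $K_{k,k}$ is the complete bipartite graph with $k$ vertices on each side ("complete bipartite component of size $k$"); in a disjoint union, each copy contributes $k$ vertices to $X$ and $k$ vertices to $Y$. -}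

module Defs where

open import Data.Bool.Base using (true; false)
open import Data.Fin.Base using (Fin; splitAt)
open import Data.Fin.Properties using (all?)
open import Data.Fin.Subset using (Subset; inside; outside; _⊆_; ⊤; ⊥; ∣_∣)
open import Data.Fin.Subset.Properties using (_⊆?_; ∣⊥∣≡0; ∣⊤∣≡n)
open import Data.List.Base using (List; []; _∷_; [_]; cartesianProductWith; filter; length)
open import Data.List.Membership.Propositional using (_∈_)
open import Data.List.Membership.Propositional.Properties using (∈-cartesianProductWith⁺)
open import Data.List.Relation.Unary.All using ([]; _∷_)
open import Data.List.Relation.Unary.AllPairs using ([]; _∷_)
open import Data.List.Relation.Unary.Any using (here; there)
open import Data.List.Relation.Unary.Unique.Propositional using (Unique)
open import Data.List.Relation.Unary.Unique.Propositional.Properties using (cartesianProductWith⁺)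
open import Data.Nat.Base using (ℕ; zero; suc; _+_; _*_)
open import Data.Nat.Divisibility using (_∣_; divides)
open import Data.Nat.Properties using (_≟_)
open import Data.Product.Base using (_×_)
open import Data.Sum.Base using (inj₁; inj₂)
open import Data.Vec.Base using (Vec; []; _∷_; lookup; map; replicate; sum; _++_)
open import Data.Vec.Properties using (∷-injective; lookup-map; lookup-replicate; lookup-splitAt)
open import Relation.Binary.PropositionalEquality using (_≡_; refl; cong; trans)
open import Relation.Nullary.Decidable using (_×-dec_)
open import Relation.Unary using (Decidable)

-- Both vertex classes X and Y are Fin n.  A set of edges is a subset of X × Y,
-- stored as a 0/1 matrix: row x is the set of those y with {x , y} in the set.
EdgeSet : ℕ → Set
EdgeSet n = Vec (Subset n) n

record BipartiteGraph (n : ℕ) : Set where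
  constructor graph
  field
    edges : EdgeSet n

open BipartiteGraph public

private
  variable
    m n k : ℕ

partnersˣ : EdgeSet n → Fin n → Subset n
partnersˣ M x = lookup M x

partnersʸ : EdgeSet n → Fin n → Subset n
partnersʸ M y = map (λ row → lookup row y) M

neighbours : BipartiteGraph n → Fin n → Subset n
neighbours G x = partnersˣ (edges G) x

size : EdgeSet n → ℕ
size M = sum (map ∣_∣ M)

IsPerfectMatching : BipartiteGraph n → EdgeSet n → Set
IsPerfectMatching {n} G M =
    (∀ x → partnersˣ M x ⊆ neighbours G x)
  × size M ≡ n
  × (∀ x → ∣ partnersˣ M x ∣ ≡ 1)
  × (∀ y → ∣ partnersʸ M y ∣ ≡ 1)

isPerfectMatching? : (G : BipartiteGraph n) → Decidable (IsPerfectMatching G)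
isPerfectMatching? {n} G M =
        all? (λ x → partnersˣ M x ⊆? neighbours G x)
  ×-dec size M ≟ n
  ×-dec all? (λ x → ∣ partnersˣ M x ∣ ≟ 1)
  ×-dec all? (λ y → ∣ partnersʸ M y ∣ ≟ 1)

allVecs : {A : Set} → List A → ∀ n → List (Vec A n)
allVecs xs zero    = [ [] ]
allVecs xs (suc n) = cartesianProductWith _∷_ xs (allVecs xs n)

allSubsets : ∀ n → List (Subset n)
allSubsets = allVecs (inside ∷ outside ∷ [])

allEdgeSets : ∀ n → List (EdgeSet n)
allEdgeSets n = allVecs (allSubsets n) n

-- The number of perfect matchings, 𝓜(G).  By allEdgeSets-complete and
-- allEdgeSets-unique below, each perfect matching is counted exactly once.
𝓜 : BipartiteGraph n → ℕ
𝓜 {n} G = length (filter (isPerfectMatching? G) (allEdgeSets n))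

complete : ∀ k → BipartiteGraph k
complete k = graph (replicate k ⊤)

infixr 5 _⊕_

-- Disjoint union, with block matrix (G 0; 0 H).
_⊕_ : BipartiteGraph m → BipartiteGraph n → BipartiteGraph (m + n)
G ⊕ H = graph (map (_++ ⊥) (edges G) ++ map (⊥ ++_) (edges H))

copies : ∀ q → BipartiteGraph k → BipartiteGraph (q * k)
copies zero    G = graph []
copies (suc q) G = G ⊕ copies q G

-- The witness q of k ∣ n is n / k.
disjointCompletes : k ∣ n → BipartiteGraph n
disjointCompletes {k} (divides q refl) = copies q (complete k)

LeftRegular : ℕ → BipartiteGraph n → Set
LeftRegular k G = ∀ x → ∣ neighbours G x ∣ ≡ k

allVecs-complete : {A : Set} {xs : List A} → (∀ a → a ∈ xs) →
                   (v : Vec A n) → v ∈ allVecs xs n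
allVecs-complete all∈ []      = here refl
allVecs-complete all∈ (a ∷ v) =
  ∈-cartesianProductWith⁺ _∷_ (all∈ a) (allVecs-complete all∈ v)

allVecs-unique : {A : Set} {xs : List A} → Unique xs → ∀ n → Unique (allVecs xs n)
allVecs-unique u zero    = [] ∷ []
allVecs-unique u (suc n) = cartesianProductWith⁺ _∷_ ∷-injective u (allVecs-unique u n)

allEdgeSets-complete : (M : EdgeSet n) → M ∈ allEdgeSets n
allEdgeSets-complete = allVecs-complete (allVecs-complete
  λ { true → here refl ; false → there (here refl) })

allEdgeSets-unique : ∀ n → Unique (allEdgeSets n)
allEdgeSets-unique n =
  allVecs-unique (allVecs-unique (((λ ()) ∷ []) ∷ [] ∷ []) n) n

∣p++⊥∣≡∣p∣ : ∀ (p : Subset m) n → ∣ p ++ ⊥ {n} ∣ ≡ ∣ p ∣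
∣p++⊥∣≡∣p∣ []            n = ∣⊥∣≡0 n
∣p++⊥∣≡∣p∣ (inside  ∷ p) n = cong suc (∣p++⊥∣≡∣p∣ p n)
∣p++⊥∣≡∣p∣ (outside ∷ p) n = ∣p++⊥∣≡∣p∣ p n

∣⊥++p∣≡∣p∣ : ∀ m (p : Subset n) → ∣ ⊥ {m} ++ p ∣ ≡ ∣ p ∣
∣⊥++p∣≡∣p∣ zero    p = refl
∣⊥++p∣≡∣p∣ (suc m) p = ∣⊥++p∣≡∣p∣ m p

complete-leftRegular : ∀ k → LeftRegular k (complete k)
complete-leftRegular k x = trans (cong ∣_∣ (lookup-replicate x ⊤)) (∣⊤∣≡n k)

⊕-leftRegular : (G : BipartiteGraph m) (H : BipartiteGraph n) →
                LeftRegular k G → LeftRegular k H → LeftRegular k (G ⊕ H)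
⊕-leftRegular {m} {n} G H rG rH x
  rewrite lookup-splitAt m (map (_++ ⊥ {n}) (edges G)) (map (⊥ {m} ++_) (edges H)) x
  with splitAt m x
... | inj₁ i rewrite lookup-map i (_++ ⊥ {n}) (edges G) =
  trans (∣p++⊥∣≡∣p∣ (neighbours G i) n) (rG i)
... | inj₂ j rewrite lookup-map j (⊥ {m} ++_) (edges H) =
  trans (∣⊥++p∣≡∣p∣ m (neighbours H j)) (rH j)

copies-leftRegular : ∀ q (G : BipartiteGraph n) → LeftRegular k G → LeftRegular k (copies q G)
copies-leftRegular zero    G r ()
copies-leftRegular (suc q) G r = ⊕-leftRegular G (copies q G) r (copies-leftRegular q G r)

disjointCompletes-leftRegular : (k∣n : k ∣ n) → LeftRegular k (disjointCompletes k∣n)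
disjointCompletes-leftRegular {k} (divides q refl) =
  copies-leftRegular q (complete k) (complete-leftRegular k)

{-# OPTIONS --safe #-}

-- The upper bound 𝓜 G ≤ (k !)^q for n = q k is Brègman's theorem for constant row sums,
-- proved by Schrijver's induction.  Let S be the set of matchings, s = |S|, A j the columns
-- allowed in row j, r j = |A j|.  Convexity of x log x applied to the distribution of ν i
-- gives s^s ≤ (r i)^s ∏_{ν ∈ S} #{μ ∈ S : μ i = ν i} for every row i.  Multiply over all rows,
-- bound each factor by induction (row i and column ν i are deleted) and regroup: for a fixed
-- ν, exactly r j - 1 of the rows i ≠ j have ν i ∈ A j, so row j loses a column that often.
-- The factors (r !)^(1/r) of Brègman's bound become natural numbers after raising
-- everything to the power L = N !, where N bounds all row sums.
--
-- The bound is attained by the disjoint union since 𝓜 is supermultiplicative under ⊕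
-- and K_{k,k} has at least k ! perfect matchings.

module Submission where

open import Algebra.Properties.CommutativeSemigroup using (interchange; x∙yz≈y∙xz; xy∙z≈xz∙y)
import Data.Bool.Properties as Bool
open import Data.Fin.Base using (Fin; zero; suc; _↑ˡ_; _↑ʳ_; splitAt; join; punchIn; punchOut)
open import Data.Fin.Properties as Fin using (join-splitAt; punchIn-punchOut)
open import Data.Fin.Subset using (Subset; inside; outside; ⊤; ⊥; ⁅_⁆; ∣_∣)
  renaming (_∈_ to _∈ˢ_; _⊆_ to _⊆ˢ_)
open import Data.Fin.Subset.Properties
  using (∣⊥∣≡0; ∣⁅x⁆∣≡1; x∈⁅x⁆; x∈⁅y⁆⇒x≡y; ∈⊤; ⊆-refl; drop-∷-⊆)
open import Data.List.Base using (List; []; _∷_; map; filter; length; cartesianProductWith; allFin)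
import Data.List.Membership.DecPropositional as DecMembership
open import Data.List.Membership.Propositional using (_∈_; _∉_; lose)
open import Data.List.Membership.Propositional.Properties
  using (∈-filter⁺; ∈-filter⁻; ∈-map⁺; ∈-map⁻; ∈-length; ∈-allFin; ∈-cartesianProductWith⁻)
open import Data.List.Properties
  using (length-filter; filter-notAll; filter-all; filter-≐; length-map; length-++; length-tabulate)
open import Data.List.Relation.Binary.Subset.Propositional using (_⊆_)
open import Data.List.Relation.Unary.All as All using ([]; _∷_)
import Data.List.Relation.Unary.All.Properties as All
open import Data.List.Relation.Unary.AllPairs using ([]; _∷_)
open import Data.List.Relation.Unary.Any using (here; there)
open import Data.List.Relation.Unary.Unique.Propositional using (Unique)
open import Data.List.Relation.Unary.Unique.Propositional.Properties
  using (filter⁺; map⁺; allFin⁺; cartesianProductWith⁺)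
open import Data.Nat.Base
open import Data.Nat.Divisibility using (_∣_; divides; ∣-trans; m∣m*n; m≤n⇒m!∣n!)
open import Data.Nat.DivMod using (_/_; m/n*n≤m; m/n*n≡m)
open import Data.Nat.ListAction using (sum; product)
open import Data.Nat.Properties hiding (_≟_)
open import Data.Nat.Tactic.RingSolver using (solve-∀)
open import Data.Product.Base using (_×_; _,_; ∃; proj₁; proj₂)
open import Data.Sum.Base using (inj₁; inj₂)
import Data.Vec.Base as Vec
open Vec using (Vec; []; _∷_; lookup; _++_; insertAt)
import Data.Vec.Properties as Vec
open import Defs
open import Function.Base using (_∘_)
open import Relation.Binary.Definitions using (DecidableEquality)
open import Relation.Binary.PropositionalEquality
open import Relation.Nullary using (¬_; Dec; yes; no; contradiction; ¬?)
open import Relation.Unary using (Decidable)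

private
  variable
    A B : Set

-- Powers and products

^-distribʳ-* : ∀ a b n → (a * b) ^ n ≡ a ^ n * b ^ n
^-distribʳ-* a b zero    = refl
^-distribʳ-* a b (suc n) =
  trans (cong (a * b *_) (^-distribʳ-* a b n)) (interchange *-commutativeSemigroup a b (a ^ n) (b ^ n))

^-^-comm : ∀ a m n → (a ^ m) ^ n ≡ (a ^ n) ^ m
^-^-comm a m n = begin
  (a ^ m) ^ n  ≡⟨ ^-*-assoc a m n ⟩
  a ^ (m * n)  ≡⟨ cong (a ^_) (*-comm m n) ⟩
  a ^ (n * m)  ≡⟨ ^-*-assoc a n m ⟨
  (a ^ n) ^ m  ∎
  where open ≡-Reasoning

^-cancelʳ-≤ : ∀ n .{{_ : NonZero n}} {a b} → a ^ n ≤ b ^ n → a ≤ b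
^-cancelʳ-≤ n {a} {b} aⁿ≤bⁿ with a ≤? b
... | yes a≤b = a≤b
... | no  a≰b = contradiction aⁿ≤bⁿ (<⇒≱ (^-monoˡ-< n (≰⇒> a≰b)))

∏ : List A → (A → ℕ) → ℕ
∏ xs f = product (map f xs)

∏-cong : ∀ (xs : List A) {f g : A → ℕ} → (∀ {x} → x ∈ xs → f x ≡ g x) → ∏ xs f ≡ ∏ xs g
∏-cong []       eq = refl
∏-cong (x ∷ xs) eq = cong₂ _*_ (eq (here refl)) (∏-cong xs (eq ∘ there))

∏-mono-≤ : ∀ (xs : List A) {f g : A → ℕ} → (∀ {x} → x ∈ xs → f x ≤ g x) → ∏ xs f ≤ ∏ xs g
∏-mono-≤ []       le = ≤-refl
∏-mono-≤ (x ∷ xs) le = *-mono-≤ (le (here refl)) (∏-mono-≤ xs (le ∘ there))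

∏-const : ∀ (xs : List A) c → ∏ xs (λ _ → c) ≡ c ^ length xs
∏-const []       c = refl
∏-const (x ∷ xs) c = cong (c *_) (∏-const xs c)

∏-distrib-* : ∀ (xs : List A) (f g : A → ℕ) → ∏ xs (λ x → f x * g x) ≡ ∏ xs f * ∏ xs g
∏-distrib-* []       f g = refl
∏-distrib-* (x ∷ xs) f g =
  trans (cong (f x * g x *_) (∏-distrib-* xs f g)) (interchange *-commutativeSemigroup (f x) (g x) _ _)

∏-distrib-^ : ∀ (xs : List A) (f : A → ℕ) n → ∏ xs (λ x → f x ^ n) ≡ ∏ xs f ^ n
∏-distrib-^ []       f n = sym (^-zeroˡ n)
∏-distrib-^ (x ∷ xs) f n =
  trans (cong (f x ^ n *_) (∏-distrib-^ xs f n)) (sym (^-distribʳ-* (f x) (∏ xs f) n))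

∏-swap : ∀ (xs : List A) (ys : List B) (f : A → B → ℕ) →
         ∏ xs (λ x → ∏ ys (f x)) ≡ ∏ ys (λ y → ∏ xs (λ x → f x y))
∏-swap []       ys f = sym (trans (∏-const ys 1) (^-zeroˡ (length ys)))
∏-swap (x ∷ xs) ys f = trans (cong (∏ ys (f x) *_) (∏-swap xs ys f))
                             (sym (∏-distrib-* ys (f x) (λ y → ∏ xs (λ x → f x y))))

∏-if : {P : A → Set} (P? : Decidable P) (xs : List A) {f : A → ℕ} {a b : ℕ} →
       (∀ {x} → x ∈ xs → P x → f x ≡ a) → (∀ {x} → x ∈ xs → ¬ P x → f x ≡ b) →
       ∏ xs f ≡ a ^ length (filter P? xs) * b ^ length (filter (¬? ∘ P?) xs)
∏-if P? []       f≡a f≡b = refl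
∏-if P? (x ∷ xs) {a = a} {b} f≡a f≡b with P? x | ∏-if P? xs (f≡a ∘ there) (f≡b ∘ there)
... | yes p | ih = trans (cong₂ _*_ (f≡a (here refl) p) ih) (sym (*-assoc a _ _))
... | no ¬p | ih = trans (cong₂ _*_ (f≡b (here refl) ¬p) ih)
                        (x∙yz≈y∙xz *-commutativeSemigroup b (a ^ length (filter P? xs)) _)

-- Giving excluded pairs the factor 1 reduces the restricted double product to the full one, where
-- `∏-swap` applies.
∏-filter-swap : {R : A → B → Set} (R? : ∀ x → Decidable (R x)) (xs : List A) (ys : List B)
                (f : A → B → ℕ) →
                ∏ xs (λ x → ∏ (filter (R? x) ys) (f x)) ≡
                ∏ ys (λ y → ∏ (filter (λ x → R? x y) xs) (λ x → f x y))
∏-filter-swap {A} {B} R? xs ys f = begin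
  ∏ xs (λ x → ∏ (filter (R? x) ys) (f x))
    ≡⟨ ∏-cong xs (λ {x} _ → ∏-filter (R? x) ys (f x)) ⟩
  ∏ xs (λ x → ∏ ys (λ y → only (R? x y) (f x y)))
    ≡⟨ ∏-swap xs ys (λ x y → only (R? x y) (f x y)) ⟩
  ∏ ys (λ y → ∏ xs (λ x → only (R? x y) (f x y)))
    ≡⟨ ∏-cong ys (λ {y} _ → ∏-filter (λ x → R? x y) xs (λ x → f x y)) ⟨
  ∏ ys (λ y → ∏ (filter (λ x → R? x y) xs) (λ x → f x y)) ∎
  where
  open ≡-Reasoning
  only : {P : Set} → Dec P → ℕ → ℕ
  only (yes _) n = n
  only (no _)  n = 1
  ∏-filter : {D : Set} {P : D → Set} (P? : Decidable P) (zs : List D) (g : D → ℕ) →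
             ∏ (filter P? zs) g ≡ ∏ zs (λ z → only (P? z) (g z))
  ∏-filter P? []       g = refl
  ∏-filter P? (z ∷ zs) g with P? z
  ... | yes _ = cong (g z *_) (∏-filter P? zs g)
  ... | no  _ = trans (∏-filter P? zs g) (sym (+-identityʳ _))

-- The inequality of arithmetic and geometric means

2mn≤m²+n² : ∀ m n → 2 * (m * n) ≤ m * m + n * n
2mn≤m²+n² m n with ≤-total m n
... | inj₁ m≤n with d , refl ← m≤n⇒∃[o]m+o≡n m≤n =
  ≤-trans (m≤m+n _ (d * d)) (≤-reflexive (ring m d))
  where
  ring : ∀ m d → 2 * (m * (m + d)) + d * d ≡ m * m + (m + d) * (m + d)
  ring = solve-∀
... | inj₂ n≤m with d , refl ← m≤n⇒∃[o]m+o≡n n≤m =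
  ≤-trans (m≤m+n _ (d * d)) (≤-reflexive (ring n d))
  where
  ring : ∀ n d → 2 * ((n + d) * n) + d * d ≡ (n + d) * (n + d) + n * n
  ring = solve-∀

-- Induction on `n`: the bound for `n` times `u`, plus `2mn≤m²+n²` for `u` and `v` with weight
-- `suc n * v ^ n`. The terms added on both sides stand in for a subtraction.
young : ∀ n u v → suc n * (u * v ^ n) ≤ u ^ suc n + n * v ^ suc n
young zero    u v = ≤-reflexive (ring u)
  where
  ring : ∀ u → 1 * (u * 1) ≡ u * 1 + 0
  ring = solve-∀
young (suc n) u v = +-cancelʳ-≤ (suc n * (u * u * P) + n * (u * v * P)) _ _ (begin
  suc (suc n) * (u * (v * P)) + (suc n * (u * u * P) + n * (u * v * P))
    ≡⟨ lhs n u v P ⟩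
  u * (suc n * (u * P)) + suc n * P * (2 * (u * v))
    ≤⟨ +-mono-≤ (*-monoʳ-≤ u (young n u v)) (*-monoʳ-≤ (suc n * P) (2mn≤m²+n² u v)) ⟩
  u * (u * Q + n * (v * P)) + suc n * P * (u * u + v * v)
    ≡⟨ rhs n u v P Q ⟩
  u * (u * Q) + suc n * (v * (v * P)) + (suc n * (u * u * P) + n * (u * v * P)) ∎)
  where
  open ≤-Reasoning
  P Q : ℕ
  P = v ^ n
  Q = u ^ n
  lhs : ∀ n u v P → suc (suc n) * (u * (v * P)) + (suc n * (u * u * P) + n * (u * v * P)) ≡
                    u * (suc n * (u * P)) + suc n * P * (2 * (u * v))
  lhs = solve-∀
  rhs : ∀ n u v P Q → u * (u * Q + n * (v * P)) + suc n * P * (u * u + v * v) ≡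
                      u * (u * Q) + suc n * (v * (v * P)) + (suc n * (u * u * P) + n * (u * v * P))
  rhs = solve-∀

-- AM-GM for `x` and `n` copies of `v`, whose mean is `u`. Adding `n * v ^ suc n` turns the left
-- side into `suc n * (u * v ^ n)`, which `young` bounds.
weighted-am-gm : ∀ n u v x → x + n * v ≡ suc n * u → x * v ^ n ≤ u ^ suc n
weighted-am-gm n u v x eq = +-cancelʳ-≤ (n * v ^ suc n) _ _ (begin
  x * v ^ n + n * v ^ suc n  ≡⟨ factor n v x (v ^ n) ⟩
  (x + n * v) * v ^ n        ≡⟨ cong (_* v ^ n) eq ⟩
  suc n * u * v ^ n          ≡⟨ *-assoc (suc n) u (v ^ n) ⟩
  suc n * (u * v ^ n)        ≤⟨ young n u v ⟩
  u ^ suc n + n * v ^ suc n  ∎)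
  where
  open ≤-Reasoning
  factor : ∀ n v x P → x * P + n * (v * P) ≡ (x + n * v) * P
  factor = solve-∀

-- The induction hypothesis replaces the tail by copies of its mean, and `weighted-am-gm` brings in
-- the head.
am-gm : ∀ xs → length xs ^ length xs * product xs ≤ sum xs ^ length xs
am-gm []             = ≤-refl
am-gm (x ∷ [])       = ≤-reflexive (ring x)
  where
  ring : ∀ x → 1 * (x * 1) ≡ (x + 0) * 1
  ring = solve-∀
-- Cancelling `n ^ suc n` needs a nonempty tail, hence the separate singleton case.
am-gm (x ∷ xs@(_ ∷ _)) = *-cancelˡ-≤ (n ^ suc n) {{m^n≢0 n (suc n)}} (begin
  n ^ suc n * (suc n ^ suc n * (x * p))
    ≡⟨ regroup n x p (n ^ n) (suc n ^ n) ⟩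
  suc n ^ n * (n * suc n * x) * (n ^ n * p)
    ≤⟨ *-monoʳ-≤ (suc n ^ n * (n * suc n * x)) (am-gm xs) ⟩
  suc n ^ n * (n * suc n * x) * s ^ n
    ≡⟨ regroup′ (suc n ^ n) (n * suc n * x) (s ^ n) ⟩
  n * suc n * x * (suc n ^ n * s ^ n)
    ≡⟨ cong (n * suc n * x *_) (^-distribʳ-* (suc n) s n) ⟨
  n * suc n * x * (suc n * s) ^ n
    -- Everything is scaled by `n * suc n` to stay in ℕ: `n * (x + s)` comes from the mean of the
    -- whole list, `suc n * s` from that of the tail.
    ≤⟨ weighted-am-gm n (n * (x + s)) (suc n * s) (n * suc n * x) (scale n x s) ⟩
  (n * (x + s)) ^ suc n
    ≡⟨ ^-distribʳ-* n (x + s) (suc n) ⟩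
  n ^ suc n * (x + s) ^ suc n ∎)
  where
  open ≤-Reasoning
  n p s : ℕ
  n = length xs
  p = product xs
  s = sum xs
  regroup : ∀ n x p P Q → n * P * (suc n * Q * (x * p)) ≡ Q * (n * suc n * x) * (P * p)
  regroup = solve-∀
  regroup′ : ∀ a b c → a * b * c ≡ b * (a * c)
  regroup′ = solve-∀
  scale : ∀ n x s → n * suc n * x + n * (suc n * s) ≡ suc n * (n * (x + s))
  scale = solve-∀

-- The value at t = 0 is chosen so that root 0 = 1 in Brègman's bound.
infixl 7 _!/_
_!/_ : ℕ → ℕ → ℕ
n !/ zero  = 0
n !/ suc t = n ! / suc t

!/-≤ : ∀ n t → t * (n !/ t) ≤ n !
!/-≤ n zero    = z≤n
!/-≤ n (suc t) = ≤-trans (≤-reflexive (*-comm (suc t) _)) (m/n*n≤m (n !) (suc t))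

-- The division is exact because `t` divides `t !`, which divides `n !`.
!/-≡ : ∀ {n t} .{{_ : NonZero t}} → t ≤ n → n !/ t * t ≡ n !
!/-≡ {n} {suc t} t≤n = m/n*n≡m (∣-trans (m∣m*n (t !)) (m≤n⇒m!∣n! t≤n))

-- Finite sets as duplicate-free lists

length-filter-¬ : {P : A → Set} (P? : Decidable P) (xs : List A) →
                  length (filter P? xs) + length (filter (¬? ∘ P?) xs) ≡ length xs
length-filter-¬ P? []       = refl
length-filter-¬ P? (x ∷ xs) with P? x
... | yes _ = cong suc (length-filter-¬ P? xs)
... | no  _ = trans (+-suc _ _) (cong suc (length-filter-¬ P? xs))

sum-≤-length* : ∀ (xs : List A) {f : A → ℕ} {k} → (∀ {x} → x ∈ xs → f x ≤ k) →
                sum (map f xs) ≤ length xs * k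
sum-≤-length* []       f≤k = z≤n
sum-≤-length* (x ∷ xs) f≤k = +-mono-≤ (f≤k (here refl)) (sum-≤-length* xs (f≤k ∘ there))

-- Injectivity is asked only on members of the list, since `Restricted` gives it for `val ν` on `U`
-- alone.
Unique-map⁺ : ∀ (f : A → B) {xs} → (∀ {x y} → x ∈ xs → y ∈ xs → f x ≡ f y → x ≡ y) →
              Unique xs → Unique (map f xs)
Unique-map⁺ f inj []       = []
Unique-map⁺ f inj (x∉ ∷ u) =
  All.map⁺ (All.tabulate λ y∈ eq → All.lookup x∉ y∈ (inj (here refl) (there y∈) eq))
  ∷ Unique-map⁺ f (λ x∈ y∈ → inj (there x∈) (there y∈)) u

module Deletion (_≟_ : DecidableEquality A) where

  delete : A → List A → List A
  delete x = filter (λ y → ¬? (x ≟ y))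

  ∈-delete⁺ : ∀ {x y xs} → y ∈ xs → x ≢ y → y ∈ delete x xs
  ∈-delete⁺ {x} = ∈-filter⁺ (λ y → ¬? (x ≟ y))

  ∈-delete⁻ : ∀ {x y} xs → y ∈ delete x xs → y ∈ xs × x ≢ y
  ∈-delete⁻ {x} xs = ∈-filter⁻ (λ y → ¬? (x ≟ y)) {xs = xs}

  length-delete-< : ∀ {x xs} → x ∈ xs → length (delete x xs) < length xs
  length-delete-< {x} {xs} x∈ = filter-notAll (λ y → ¬? (x ≟ y)) xs (lose x∈ (λ x≢x → x≢x refl))

  Unique-⊆⇒length-≤ : ∀ {xs ys} → Unique xs → xs ⊆ ys → length xs ≤ length ys
  Unique-⊆⇒length-≤ []       xs⊆ys = z≤n
  Unique-⊆⇒length-≤ (x∉ ∷ u) xs⊆ys = ≤-trans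
    (s≤s (Unique-⊆⇒length-≤ u λ y∈ → ∈-delete⁺ (xs⊆ys (there y∈)) (All.lookup x∉ y∈)))
    (length-delete-< (xs⊆ys (here refl)))

  Unique-⊆⊇⇒length-≡ : ∀ {xs ys} → Unique xs → Unique ys → xs ⊆ ys → ys ⊆ xs → length xs ≡ length ys
  Unique-⊆⊇⇒length-≡ u v xs⊆ys ys⊆xs =
    ≤-antisym (Unique-⊆⇒length-≤ u xs⊆ys) (Unique-⊆⇒length-≤ v ys⊆xs)

  delete-Unique : ∀ {x xs} → Unique xs → Unique (delete x xs)
  delete-Unique {x} = filter⁺ (λ y → ¬? (x ≟ y))

  suc-length-delete : ∀ {x xs} → Unique xs → x ∈ xs → suc (length (delete x xs)) ≡ length xs
  suc-length-delete {x} {xs} u x∈ = ≤-antisym (length-delete-< x∈) (Unique-⊆⇒length-≤ u xs⊆)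
    where
    xs⊆ : xs ⊆ x ∷ delete x xs
    xs⊆ {y} y∈ with x ≟ y
    ... | yes x≡y = here (sym x≡y)
    ... | no  x≢y = there (∈-delete⁺ y∈ x≢y)

  delete-∉ : ∀ {x xs} → x ∉ xs → delete x xs ≡ xs
  delete-∉ {x} x∉ = filter-all (λ y → ¬? (x ≟ y)) (All.¬Any⇒All¬ _ x∉)

-- Fibres of a map and convexity

module _ {Ω C : Set} (_≟_ : DecidableEquality C) (f : Ω → C) where

  fibre : List Ω → C → List Ω
  fibre S c = filter (λ ν → f ν ≟ c) S

  -- Each `ν` is counted in the summand at `f ν`; repetitions in `cs` can only enlarge the right
  -- side.
  sum-fibres : (w : Ω → ℕ) (S : List Ω) {cs : List C} → (∀ {ν} → ν ∈ S → f ν ∈ cs) →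
               sum (map w S) ≤ sum (map (λ c → sum (map w (fibre S c))) cs)
  sum-fibres w []      f∈ = z≤n
  sum-fibres w (ν ∷ S) f∈ = ≤-trans (+-monoʳ-≤ (w ν) (sum-fibres w S (f∈ ∘ there)))
                                    (raise (f∈ (here refl)))
    where
    h h′ : C → ℕ
    h  c = sum (map w (fibre S c))
    h′ c = sum (map w (fibre (ν ∷ S) c))
    h≤h′ : ∀ c → h c ≤ h′ c
    h≤h′ c with f ν ≟ c
    ... | yes _ = m≤n+m _ (w ν)
    ... | no  _ = ≤-refl
    raise-at : w ν + h (f ν) ≤ h′ (f ν)
    raise-at with f ν ≟ f ν
    ... | yes _ = ≤-refl
    ... | no ≢  = contradiction refl ≢
    sum-h≤h′ : ∀ cs → sum (map h cs) ≤ sum (map h′ cs)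
    sum-h≤h′ []       = z≤n
    sum-h≤h′ (c ∷ cs) = +-mono-≤ (h≤h′ c) (sum-h≤h′ cs)
    raise : ∀ {cs} → f ν ∈ cs → w ν + sum (map h cs) ≤ sum (map h′ cs)
    raise {_ ∷ cs} (here refl) =
      ≤-trans (≤-reflexive (sym (+-assoc (w ν) (h (f ν)) _))) (+-mono-≤ raise-at (sum-h≤h′ cs))
    raise {c ∷ _} (there p) =
      ≤-trans (≤-reflexive (x∙yz≈y∙xz +-commutativeSemigroup (w ν) (h c) _))
              (+-mono-≤ (h≤h′ c) (raise p))

  -- Convexity of x log x, obtained from AM-GM for the numbers s! / |fibre of ν|,
  -- whose sum over each fibre is at most s!.
  fibre-convexity : (S : List Ω) (cs : List C) → (∀ {ν} → ν ∈ S → f ν ∈ cs) →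
                    length S ^ length S ≤ length cs ^ length S * ∏ S (λ ν → length (fibre S (f ν)))
  fibre-convexity S cs f∈ = *-cancelʳ-≤ _ _ ((s !) ^ s) {{m^n≢0 (s !) s {{s !≢0}}}} (begin
    s ^ s * (s !) ^ s                   ≡⟨ cong (s ^ s *_) y*t ⟨
    s ^ s * (∏ S y * ∏ S (t ∘ f))     ≡⟨ *-assoc (s ^ s) _ _ ⟨
    s ^ s * ∏ S y * ∏ S (t ∘ f)       ≤⟨ *-monoˡ-≤ _ am-gm-y ⟩
    sum (map y S) ^ s * ∏ S (t ∘ f)   ≤⟨ *-monoˡ-≤ _ (^-monoˡ-≤ s sum-y) ⟩
    (r * s !) ^ s * ∏ S (t ∘ f)       ≡⟨ cong (_* ∏ S (t ∘ f)) (^-distribʳ-* r (s !) s) ⟩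
    r ^ s * (s !) ^ s * ∏ S (t ∘ f)     ≡⟨ xy∙z≈xz∙y *-commutativeSemigroup (r ^ s) _ _ ⟩
    r ^ s * ∏ S (t ∘ f) * (s !) ^ s     ∎)
    where
    open ≤-Reasoning
    s r : ℕ
    s = length S
    r = length cs
    t : C → ℕ
    t c = length (fibre S c)
    y : Ω → ℕ
    y ν = s !/ t (f ν)
    am-gm-y : s ^ s * ∏ S y ≤ sum (map y S) ^ s
    am-gm-y = subst (λ n → n ^ n * ∏ S y ≤ sum (map y S) ^ n) (length-map y S) (am-gm (map y S))
    y*t : ∏ S y * ∏ S (t ∘ f) ≡ (s !) ^ s
    y*t = trans (sym (∏-distrib-* S y (t ∘ f))) (trans (∏-cong S λ {ν} ν∈ →
            -- `ν` lies in its own fibre, so `t (f ν)` is positive; being at most `s`, it divides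
            -- `s !`.
            !/-≡ {{>-nonZero (∈-length (∈-filter⁺ (λ ν′ → f ν′ ≟ f ν) ν∈ refl))}}
                 (length-filter (λ ν′ → f ν′ ≟ f ν) S))
            (∏-const S (s !)))
    sum-y : sum (map y S) ≤ r * s !
    sum-y = ≤-trans (sum-fibres y S f∈) (sum-≤-length* cs λ {c} _ →
      ≤-trans (sum-≤-length* (fibre S c) λ ν∈ →
                ≤-reflexive (cong (λ c′ → s !/ t c′) (proj₂ (∈-filter⁻ (λ ν → f ν ≟ c) {xs = S} ν∈))))
              (!/-≤ s (t c)))

-- Brègman's bound

-- Rows, columns and matchings are abstract: the induction shrinks the lists `S`, `U` and `A j`
-- while `val`, `N` and hence `L` stay fixed, so no smaller matrices have to be formed.
module Bregman {Ω I C : Set} (_≟ᴵ_ : DecidableEquality I) (_≟ᶜ_ : DecidableEquality C)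
               (val : Ω → I → C) (N : ℕ) where

  open Deletion _≟ᴵ_ using () renaming
    (delete to deleteᴵ; ∈-delete⁺ to ∈-deleteᴵ⁺; ∈-delete⁻ to ∈-deleteᴵ⁻)
  open Deletion _≟ᶜ_ using () renaming
    (delete to deleteᶜ; ∈-delete⁺ to ∈-deleteᶜ⁺; ∈-delete⁻ to ∈-deleteᶜ⁻)
  private
    module I = Deletion _≟ᴵ_
    module C = Deletion _≟ᶜ_

  L : ℕ
  L = N !

  -- The L-th power of (r !)^(1/r).
  root : ℕ → ℕ
  root r = (r !) ^ (N !/ r)

  -- The exponents multiply to exactly `N !` when `1 ≤ r ≤ N`; for `r = 0` both sides are 1.
  root-^ : ∀ {r} → r ≤ N → root r ^ r ≡ (r !) ^ L
  root-^ {zero}  r≤N = sym (^-zeroˡ L)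
  root-^ {suc r} r≤N = trans (^-*-assoc (suc r !) (N !/ suc r) (suc r)) (cong (suc r ! ^_) (!/-≡ r≤N))

  -- The factor `suc t ^ L` lifts `root t ^ t`, which is `(t !) ^ L`, to `(suc t !) ^ L`, which is
  -- `root (suc t) ^ suc t`. In the application a row has `suc t` columns, `t` counts the other rows
  -- whose deletion costs it a column, and `u` those that leave it unchanged.
  root-suc : ∀ t u → suc t ≤ N → suc t ^ L * (root t ^ t * root (suc t) ^ u) ≡ root (suc t) ^ suc (t + u)
  root-suc t u t<N = begin
    suc t ^ L * (root t ^ t * root (suc t) ^ u)
      ≡⟨ *-assoc (suc t ^ L) (root t ^ t) _ ⟨
    suc t ^ L * root t ^ t * root (suc t) ^ u
      ≡⟨ cong (λ x → suc t ^ L * x * root (suc t) ^ u) (root-^ (<⇒≤ t<N)) ⟩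
    suc t ^ L * (t !) ^ L * root (suc t) ^ u
      ≡⟨ cong (_* root (suc t) ^ u) (^-distribʳ-* (suc t) (t !) L) ⟨
    (suc t !) ^ L * root (suc t) ^ u
      ≡⟨ cong (_* root (suc t) ^ u) (root-^ t<N) ⟨
    root (suc t) ^ suc t * root (suc t) ^ u
      ≡⟨ ^-distribˡ-+-* (root (suc t)) (suc t) u ⟨
    root (suc t) ^ suc (t + u) ∎
    where open ≡-Reasoning

  -- S is a set of matchings that agree outside the rows U; A j lists the columns
  -- still allowed in row j.
  record Restricted (S : List Ω) (U : List I) (A : I → List C) : Set where
    field
      uniqueS   : Unique S
      uniqueU   : Unique U
      uniqueA   : ∀ {j} → j ∈ U → Unique (A j)
      separated : ∀ {μ ν} → μ ∈ S → ν ∈ S → (∀ {j} → j ∈ U → val μ j ≡ val ν j) → μ ≡ ν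
      inj       : ∀ {ν i j} → ν ∈ S → i ∈ U → j ∈ U → val ν i ≡ val ν j → i ≡ j
      allowed   : ∀ {ν j} → ν ∈ S → j ∈ U → val ν j ∈ A j
      surj      : ∀ {ν j c} → ν ∈ S → j ∈ U → c ∈ A j → ∃ λ i → i ∈ U × val ν i ≡ c

  assigning : List Ω → I → C → List Ω
  assigning S i = fibre _≟ᶜ_ (λ ν → val ν i) S

  -- Fixing row `i` to `c` deletes that row and column. By `inj` no other row takes `c`, so its
  -- removal from `A j` excludes no value in use; by `surj` a column other than `c` is met in a row
  -- other than `i`. Matchings with value `c` at `i` that agree elsewhere on `U` agree on all of
  -- `U`.
  assign : ∀ {S U A i} → Restricted S U A → i ∈ U → (c : C) →
           Restricted (assigning S i c) (deleteᴵ i U) (λ j → deleteᶜ c (A j))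
  assign {S} {U} {A} {i} R i∈U c = record
    { uniqueS   = filter⁺ (λ ν → val ν i ≟ᶜ c) uniqueS
    ; uniqueU   = I.delete-Unique uniqueU
    ; uniqueA   = λ j∈ → C.delete-Unique (uniqueA (old j∈))
    ; separated = λ {μ} {ν} μ∈ ν∈ eq → separated (S⁻ μ∈) (S⁻ ν∈) (agree μ∈ ν∈ eq)
    ; inj       = λ ν∈ i∈ j∈ → inj (S⁻ ν∈) (old i∈) (old j∈)
    ; allowed   = λ ν∈ j∈ → ∈-deleteᶜ⁺ (allowed (S⁻ ν∈) (old j∈))
        λ c≡ → proj₂ (∈-deleteᴵ⁻ U j∈) (inj (S⁻ ν∈) i∈U (old j∈) (trans (at-i ν∈) c≡))
    ; surj      = surj′
    }
    where
    open Restricted R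
    S⁻ : ∀ {ν} → ν ∈ assigning S i c → ν ∈ S
    S⁻ ν∈ = proj₁ (∈-filter⁻ (λ ν → val ν i ≟ᶜ c) {xs = S} ν∈)
    at-i : ∀ {ν} → ν ∈ assigning S i c → val ν i ≡ c
    at-i ν∈ = proj₂ (∈-filter⁻ (λ ν → val ν i ≟ᶜ c) {xs = S} ν∈)
    old : ∀ {j} → j ∈ deleteᴵ i U → j ∈ U
    old j∈ = proj₁ (∈-deleteᴵ⁻ U j∈)
    agree : ∀ {μ ν} → μ ∈ assigning S i c → ν ∈ assigning S i c →
            (∀ {j} → j ∈ deleteᴵ i U → val μ j ≡ val ν j) → ∀ {j} → j ∈ U → val μ j ≡ val ν j
    agree μ∈ ν∈ eq {j} j∈ with i ≟ᴵ j
    ... | yes refl = trans (at-i μ∈) (sym (at-i ν∈))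
    ... | no  i≢j  = eq (∈-deleteᴵ⁺ j∈ i≢j)
    surj′ : ∀ {ν j d} → ν ∈ assigning S i c → j ∈ deleteᴵ i U → d ∈ deleteᶜ c (A j) →
            ∃ λ i′ → i′ ∈ deleteᴵ i U × val ν i′ ≡ d
    surj′ {j = j} ν∈ j∈ d∈ with d∈A , c≢d ← ∈-deleteᶜ⁻ (A j) d∈
      with i′ , i′∈ , eq ← surj (S⁻ ν∈) (old j∈) d∈A =
      i′ , ∈-deleteᴵ⁺ i′∈ (λ { refl → c≢d (trans (sym (at-i ν∈)) eq) }) , eq

  module _ {S U A} (R : Restricted S U A) (A≤N : ∀ {j} → j ∈ U → length (A j) ≤ N) where
    open Restricted R

    -- Exactly |A j| - 1 of the rows other than j take their value in A j.
    row-factor : ∀ {ν j} → ν ∈ S → j ∈ U →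
      length (A j) ^ L * ∏ (deleteᴵ j U) (λ i → root (length (deleteᶜ (val ν i) (A j)))) ≡
      root (length (A j)) ^ length U
    row-factor {ν} {j} ν∈ j∈ = begin
      r ^ L * ∏ V (λ i → root (length (deleteᶜ (val ν i) (A j))))
        -- A row hitting `A j` costs it one column and leaves `t`; any other row leaves all `r`.
        ≡⟨ cong (r ^ L *_) (∏-if hits? V
             (λ _ hit → cong root (suc-injective
               (trans (C.suc-length-delete (uniqueA j∈) hit) (sym suc-t≡r))))
             (λ _ miss → cong (root ∘ length) (C.delete-∉ miss))) ⟩
      r ^ L * (root t ^ t * root r ^ u)
        ≡⟨ cong (λ x → x ^ L * (root t ^ t * root x ^ u)) suc-t≡r ⟨
      suc t ^ L * (root t ^ t * root (suc t) ^ u)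
        ≡⟨ root-suc t u (≤-trans (≤-reflexive suc-t≡r) (A≤N j∈)) ⟩
      root (suc t) ^ suc (t + u)
        ≡⟨ cong₂ (λ x y → root x ^ y) suc-t≡r
             (trans (cong suc (length-filter-¬ hits? V)) (I.suc-length-delete uniqueU j∈)) ⟩
      root r ^ length U ∎
      where
      open ≡-Reasoning
      open DecMembership _≟ᶜ_ using (_∈?_)
      V : List I
      V = deleteᴵ j U
      hits? : ∀ i → Dec (val ν i ∈ A j)
      hits? i = val ν i ∈? A j
      r t u : ℕ
      r = length (A j)
      t = length (filter hits? V)
      u = length (filter (¬? ∘ hits?) V)
      hit⁻ : ∀ {i} → i ∈ filter hits? V → i ∈ U × j ≢ i × val ν i ∈ A j
      hit⁻ i∈ = let i∈V , hit = ∈-filter⁻ hits? {xs = V} i∈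
                    i∈U , j≢i = ∈-deleteᴵ⁻ U i∈V in i∈U , j≢i , hit
      -- `val ν` is a bijection from the other rows hitting `A j` onto `A j` without `val ν j`:
      -- `inj` keeps the values off `val ν j`, and `surj` supplies a row for each remaining column.
      to : map (val ν) (filter hits? V) ⊆ deleteᶜ (val ν j) (A j)
      to c∈ with i , i∈ , refl ← ∈-map⁻ (val ν) c∈ =
        let i∈U , j≢i , hit = hit⁻ i∈ in ∈-deleteᶜ⁺ hit (j≢i ∘ inj ν∈ j∈ i∈U)
      from : deleteᶜ (val ν j) (A j) ⊆ map (val ν) (filter hits? V)
      from c∈ with c∈A , ≢c ← ∈-deleteᶜ⁻ (A j) c∈ with i , i∈ , refl ← surj ν∈ j∈ c∈A =
        ∈-map⁺ (val ν) (∈-filter⁺ hits? (∈-deleteᴵ⁺ i∈ (≢c ∘ cong (val ν))) c∈A)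
      suc-t≡r : suc t ≡ r
      suc-t≡r = trans
        (cong suc (trans (sym (length-map (val ν) (filter hits? V)))
          (C.Unique-⊆⊇⇒length-≡
            (Unique-map⁺ (val ν) (λ x∈ y∈ → inj ν∈ (proj₁ (hit⁻ x∈)) (proj₁ (hit⁻ y∈)))
                         (filter⁺ hits? (I.delete-Unique uniqueU)))
            (C.delete-Unique (uniqueA j∈)) to from)))
        (C.suc-length-delete (uniqueA j∈) (allowed ν∈ j∈))

    -- Both sides are raised to the power `m * s`: `fibre-convexity` produces `s ^ s` and is used
    -- once for each of the `m` rows. On the right each of the `s` matchings contributes the same
    -- `m`-th power, by `matching-factor`.
    bregman-step : .{{NonZero (length S)}} → .{{NonZero (length U)}} →
      (∀ {i} → i ∈ U → ∀ c → length (assigning S i c) ^ L ≤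
                              ∏ (deleteᴵ i U) (λ j → root (length (deleteᶜ c (A j))))) →
      length S ^ L ≤ ∏ U (λ j → root (length (A j)))
    bregman-step IH = ^-cancelʳ-≤ (m * s) {{m*n≢0 m s}} (begin
      (s ^ L) ^ (m * s)                                       ≡⟨ cong ((s ^ L) ^_) (*-comm m s) ⟩
      (s ^ L) ^ (s * m)                                       ≡⟨ ^-*-assoc (s ^ L) s m ⟨
      ((s ^ L) ^ s) ^ m                                       ≡⟨ cong (_^ m) (^-^-comm s L s) ⟩
      ((s ^ s) ^ L) ^ m                                       ≡⟨ ∏-const U _ ⟨
      ∏ U (λ _ → (s ^ s) ^ L)                                 ≤⟨ ∏-mono-≤ U row-bound ⟩
      ∏ U (λ i → ∏ S (λ ν → r i ^ L * ∏ (deleteᴵ i U) (g ν i)))  ≡⟨ ∏-swap U S _ ⟩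
      ∏ S (λ ν → ∏ U (λ i → r i ^ L * ∏ (deleteᴵ i U) (g ν i)))  ≡⟨ ∏-cong S matching-factor ⟩
      ∏ S (λ _ → ∏ U (λ j → root (r j)) ^ m)                  ≡⟨ ∏-const S _ ⟩
      (∏ U (λ j → root (r j)) ^ m) ^ s                        ≡⟨ ^-*-assoc _ m s ⟩
      ∏ U (λ j → root (r j)) ^ (m * s)                        ∎)
      where
      open ≤-Reasoning
      s m : ℕ
      s = length S
      m = length U
      r : I → ℕ
      r j = length (A j)
      g : Ω → I → I → ℕ
      g ν i j = root (length (deleteᶜ (val ν i) (A j)))
      row-bound : ∀ {i} → i ∈ U → (s ^ s) ^ L ≤ ∏ S (λ ν → r i ^ L * ∏ (deleteᴵ i U) (g ν i))
      row-bound {i} i∈ = begin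
        (s ^ s) ^ L
          ≤⟨ ^-monoˡ-≤ L (fibre-convexity _≟ᶜ_ (λ ν → val ν i) S (A i) (λ ν∈ → allowed ν∈ i∈)) ⟩
        (r i ^ s * ∏ S (λ ν → length (assigning S i (val ν i)))) ^ L
          ≡⟨ ^-distribʳ-* (r i ^ s) _ L ⟩
        (r i ^ s) ^ L * ∏ S (λ ν → length (assigning S i (val ν i))) ^ L
          ≡⟨ cong₂ _*_ (trans (^-^-comm (r i) s L) (sym (∏-const S (r i ^ L))))
                       (sym (∏-distrib-^ S _ L)) ⟩
        ∏ S (λ _ → r i ^ L) * ∏ S (λ ν → length (assigning S i (val ν i)) ^ L)
          ≤⟨ *-monoʳ-≤ (∏ S (λ _ → r i ^ L)) (∏-mono-≤ S (λ {ν} _ → IH i∈ (val ν i))) ⟩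
        ∏ S (λ _ → r i ^ L) * ∏ S (λ ν → ∏ (deleteᴵ i U) (g ν i))
          ≡⟨ ∏-distrib-* S (λ _ → r i ^ L) _ ⟨
        ∏ S (λ ν → r i ^ L * ∏ (deleteᴵ i U) (g ν i)) ∎
      matching-factor : ∀ {ν} → ν ∈ S →
        ∏ U (λ i → r i ^ L * ∏ (deleteᴵ i U) (g ν i)) ≡ ∏ U (λ j → root (r j)) ^ m
      matching-factor {ν} ν∈ = begin-equality
        ∏ U (λ i → r i ^ L * ∏ (deleteᴵ i U) (g ν i))
          ≡⟨ ∏-distrib-* U (λ i → r i ^ L) _ ⟩
        ∏ U (λ i → r i ^ L) * ∏ U (λ i → ∏ (deleteᴵ i U) (g ν i))
          -- The pairs `i ≢ j` are regrouped by the row `j` whose columns are affected instead of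
          -- the row `i` that is deleted.
          ≡⟨ cong (∏ U (λ i → r i ^ L) *_) (∏-filter-swap (λ i j → ¬? (i ≟ᴵ j)) U U (g ν)) ⟩
        ∏ U (λ i → r i ^ L) * ∏ U (λ j → ∏ (filter (λ i → ¬? (i ≟ᴵ j)) U) (λ i → g ν i j))
          ≡⟨ ∏-distrib-* U (λ i → r i ^ L) _ ⟨
        ∏ U (λ j → r j ^ L * ∏ (filter (λ i → ¬? (i ≟ᴵ j)) U) (λ i → g ν i j))
          ≡⟨ ∏-cong U (λ {j} _ → cong (λ V → r j ^ L * ∏ V (λ i → g ν i j))
               (filter-≐ (λ i → ¬? (i ≟ᴵ j)) (λ i → ¬? (j ≟ᴵ i)) ((_∘ sym) , (_∘ sym)) U)) ⟩
        ∏ U (λ j → r j ^ L * ∏ (deleteᴵ j U) (λ i → g ν i j))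
          ≡⟨ ∏-cong U (row-factor ν∈) ⟩
        ∏ U (λ j → root (r j) ^ m)
          ≡⟨ ∏-distrib-^ U _ m ⟩
        ∏ U (λ j → root (r j)) ^ m ∎

  -- The bound `m` on the number of rows drives the induction, since `deleteᴵ` is not structurally
  -- smaller. `N` can stay fixed because deletion never lengthens an `A j`.
  bregman : ∀ m {S U A} → length U ≤ m → Restricted S U A → (∀ {j} → j ∈ U → length (A j) ≤ N) →
            length S ^ L ≤ ∏ U (λ j → root (length (A j)))
  -- An empty `S` gives 0 on the left, because `L = N !` is positive.
  bregman m {[]} {U} {A} _ R A≤N = ≤-trans (≤-reflexive (0^ L)) z≤n
    where
    0^ : ∀ n .{{_ : NonZero n}} → 0 ^ n ≡ 0
    0^ (suc n) = refl
    instance _ = N !≢0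
  bregman m {_ ∷ []} {[]} _ R A≤N = ≤-reflexive (^-zeroˡ L)
  -- Any two matchings agree vacuously on no rows, so `separated` identifies them.
  bregman m {_ ∷ _ ∷ _} {[]} _ R A≤N with (μ≢ν ∷ _) ∷ _ ← Restricted.uniqueS R =
    contradiction (Restricted.separated R (here refl) (there (here refl)) λ ()) μ≢ν
  bregman (suc m) {_ ∷ _} {_ ∷ _} {A} (s≤s U≤m) R A≤N = bregman-step R A≤N λ {i} i∈ c →
    bregman m (≤-pred (≤-trans (I.length-delete-< i∈) (s≤s U≤m))) (assign R i∈ c)
      (λ {j} j∈ → ≤-trans (length-filter (λ d → ¬? (c ≟ᶜ d)) (A j)) (A≤N (proj₁ (∈-deleteᴵ⁻ _ j∈))))

-- Perfect matchings

private
  variable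
    k m n : ℕ

∣p∣≡0⇒p≡⊥ : ∀ (p : Subset n) → ∣ p ∣ ≡ 0 → p ≡ ⊥
∣p∣≡0⇒p≡⊥ []            _  = refl
∣p∣≡0⇒p≡⊥ (outside ∷ p) eq = cong (outside ∷_) (∣p∣≡0⇒p≡⊥ p eq)

∣p∣≡1⇒p≡⁅x⁆ : ∀ (p : Subset n) → ∣ p ∣ ≡ 1 → ∃ λ x → p ≡ ⁅ x ⁆
∣p∣≡1⇒p≡⁅x⁆ (inside  ∷ p) eq = zero , cong (inside ∷_) (∣p∣≡0⇒p≡⊥ p (suc-injective eq))
∣p∣≡1⇒p≡⁅x⁆ (outside ∷ p) eq = let x , p≡ = ∣p∣≡1⇒p≡⁅x⁆ p eq in suc x , cong (outside ∷_) p≡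

⁅⁆-injective : ∀ {x y : Fin n} → ⁅ x ⁆ ≡ ⁅ y ⁆ → x ≡ y
⁅⁆-injective {x = x} {y} eq = x∈⁅y⁆⇒x≡y y (subst (x ∈ˢ_) eq (x∈⁅x⁆ x))

elements : Subset n → List (Fin n)
elements []            = []
elements (inside  ∷ p) = zero ∷ map suc (elements p)
elements (outside ∷ p) = map suc (elements p)

length-elements : ∀ (p : Subset n) → length (elements p) ≡ ∣ p ∣
length-elements []            = refl
length-elements (inside  ∷ p) = cong suc (trans (length-map suc (elements p)) (length-elements p))
length-elements (outside ∷ p) = trans (length-map suc (elements p)) (length-elements p)

elements-Unique : ∀ (p : Subset n) → Unique (elements p)
elements-Unique []            = []
elements-Unique (inside  ∷ p) =
  All.map⁺ (All.universal (λ _ ()) (elements p)) ∷ map⁺ Fin.suc-injective (elements-Unique p)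
elements-Unique (outside ∷ p) = map⁺ Fin.suc-injective (elements-Unique p)

∈-elements⁺ : ∀ {p : Subset n} {x} → x ∈ˢ p → x ∈ elements p
∈-elements⁺ {p = inside  ∷ p} Vec.here         = here refl
∈-elements⁺ {p = inside  ∷ p} (Vec.there x∈p)  = there (∈-map⁺ suc (∈-elements⁺ x∈p))
∈-elements⁺ {p = outside ∷ p} (Vec.there x∈p)  = ∈-map⁺ suc (∈-elements⁺ x∈p)

_≟ˢ_ : DecidableEquality (Subset n)
_≟ˢ_ = Vec.≡-dec Bool._≟_

_≟ᴱ_ : DecidableEquality (EdgeSet n)
_≟ᴱ_ = Vec.≡-dec _≟ˢ_

partnersʸ⇒partnersˣ : ∀ (M : EdgeSet n) {x y} → x ∈ˢ partnersʸ M y → y ∈ˢ partnersˣ M x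
partnersʸ⇒partnersˣ M {x} {y} x∈ =
  Vec.lookup⇒[]= y _ (trans (sym (Vec.lookup-map x _ M)) (Vec.[]=⇒lookup x∈))

partnersˣ⇒partnersʸ : ∀ (M : EdgeSet n) {x y} → y ∈ˢ partnersˣ M x → x ∈ˢ partnersʸ M y
partnersˣ⇒partnersʸ M {x} {y} y∈ =
  Vec.lookup⇒[]= x _ (trans (Vec.lookup-map x _ M) (Vec.[]=⇒lookup y∈))

matchings : BipartiteGraph n → List (EdgeSet n)
matchings {n} G = filter (isPerfectMatching? G) (allEdgeSets n)

∈-matchings⁻ : ∀ (G : BipartiteGraph n) {M} → M ∈ matchings G → IsPerfectMatching G M
∈-matchings⁻ {n} G M∈ = proj₂ (∈-filter⁻ (isPerfectMatching? G) {xs = allEdgeSets n} M∈)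

matchings-Unique : ∀ (G : BipartiteGraph n) → Unique (matchings G)
matchings-Unique {n} G = filter⁺ (isPerfectMatching? G) (allEdgeSets-unique n)

-- A matched vertex y is encoded by the row ⁅ y ⁆ of the matching, so that the
-- value of M at x is a total function of M and x.
matchings-Restricted : ∀ k (G : BipartiteGraph n) →
  Bregman.Restricted Fin._≟_ _≟ˢ_ (lookup {n = n}) k
    (matchings G) (allFin n) (λ x → map ⁅_⁆ (elements (neighbours G x)))
matchings-Restricted {n} k G = record
  { uniqueS   = matchings-Unique G
  ; uniqueU   = allFin⁺ n
  ; uniqueA   = λ {x} _ → map⁺ ⁅⁆-injective (elements-Unique (neighbours G x))
  ; separated = λ {M} {M′} _ _ eq → trans (sym (Vec.tabulate∘lookup M))
                  (trans (Vec.tabulate-cong (λ x → eq (∈-allFin x))) (Vec.tabulate∘lookup M′))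
  ; inj       = λ {M} M∈ _ _ → row-injective M (∈-matchings⁻ G M∈)
  ; allowed   = λ {M} M∈ _ → row-allowed M (∈-matchings⁻ G M∈)
  ; surj      = λ {M} M∈ _ c∈ → row-surjective M (∈-matchings⁻ G M∈) (∈-map⁻ ⁅_⁆ c∈)
  }
  where
  row-injective : ∀ M {x x′} → IsPerfectMatching G M → lookup M x ≡ lookup M x′ → x ≡ x′
  row-injective M {x} {x′} (_ , _ , rows , cols) eq
    with y , row≡ ← ∣p∣≡1⇒p≡⁅x⁆ _ (rows x)
    with z , col≡ ← ∣p∣≡1⇒p≡⁅x⁆ _ (cols y) =
    -- Both rows contain column `y`, whose single partner is `z`.
    trans (at-z (subst (y ∈ˢ_) (sym row≡) (x∈⁅x⁆ y)))
          (sym (at-z (subst (y ∈ˢ_) (trans (sym row≡) eq) (x∈⁅x⁆ y))))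
    where
    at-z : ∀ {w} → y ∈ˢ partnersˣ M w → w ≡ z
    at-z {w} y∈ = x∈⁅y⁆⇒x≡y z (subst (w ∈ˢ_) col≡ (partnersˣ⇒partnersʸ M y∈))
  row-allowed : ∀ M {x} → IsPerfectMatching G M → lookup M x ∈ map ⁅_⁆ (elements (neighbours G x))
  row-allowed M {x} (sub , _ , rows , _) with y , row≡ ← ∣p∣≡1⇒p≡⁅x⁆ _ (rows x) =
    subst (_∈ _) (sym row≡)
      (∈-map⁺ ⁅_⁆ (∈-elements⁺ (sub x (subst (y ∈ˢ_) (sym row≡) (x∈⁅x⁆ y)))))
  row-surjective : ∀ M {c} {ys : List (Fin n)} → IsPerfectMatching G M →
                   (∃ λ y → y ∈ ys × c ≡ ⁅ y ⁆) → ∃ λ x → x ∈ allFin n × lookup M x ≡ c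
  row-surjective M (_ , _ , rows , cols) (y , _ , refl)
    with x , col≡ ← ∣p∣≡1⇒p≡⁅x⁆ _ (cols y)
    with y′ , row≡ ← ∣p∣≡1⇒p≡⁅x⁆ _ (rows x) =
    x , ∈-allFin x , trans row≡ (cong ⁅_⁆ (sym (x∈⁅y⁆⇒x≡y y′ (subst (y ∈ˢ_) row≡
      (partnersʸ⇒partnersˣ M (subst (x ∈ˢ_) (sym col≡) (x∈⁅x⁆ x)))))))

-- With all row sums equal to `k` the choice `N = k` gives `L = k !`. The `q * k` factors `root k`
-- multiply to `((k !) ^ q) ^ (k !)`, and the power `k !` cancels.
𝓜-upper : ∀ q k .{{_ : NonZero k}} (G : BipartiteGraph (q * k)) → LeftRegular k G →
          𝓜 G ≤ (k !) ^ q
𝓜-upper q k G reg = ^-cancelʳ-≤ (k !) {{k !≢0}} (begin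
  𝓜 G ^ (k !)
    ≤⟨ bregman (q * k) (≤-reflexive (length-tabulate {n = q * k} (λ x → x))) (matchings-Restricted k G)
         (λ {x} _ → ≤-reflexive (length-A x)) ⟩
  ∏ (allFin (q * k)) (λ x → root (length (map ⁅_⁆ (elements (neighbours G x)))))
    ≡⟨ ∏-cong (allFin (q * k)) (λ {x} _ → cong root (length-A x)) ⟩
  ∏ (allFin (q * k)) (λ _ → root k)
    ≡⟨ ∏-const (allFin (q * k)) (root k) ⟩
  root k ^ length (allFin (q * k))
    ≡⟨ cong (root k ^_) (trans (length-tabulate {n = q * k} (λ x → x)) (*-comm q k)) ⟩
  root k ^ (k * q)
    ≡⟨ ^-*-assoc (root k) k q ⟨
  (root k ^ k) ^ q
    ≡⟨ cong (_^ q) (root-^ ≤-refl) ⟩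
  ((k !) ^ (k !)) ^ q
    ≡⟨ ^-^-comm (k !) (k !) q ⟩
  ((k !) ^ q) ^ (k !) ∎)
  where
  open ≤-Reasoning
  open Bregman Fin._≟_ _≟ˢ_ (lookup {n = q * k}) k
  length-A : ∀ x → length (map ⁅_⁆ (elements (neighbours G x))) ≡ k
  length-A x = trans (length-map ⁅_⁆ (elements (neighbours G x)))
                     (trans (length-elements (neighbours G x)) (reg x))

-- Lower bounds from explicit families of matchings

-- The size clause of a perfect matching follows from its row clause. Rectangular matrices let the
-- induction peel off rows.
size-≡ : ∀ (M : Vec (Subset m) n) → (∀ x → ∣ lookup M x ∣ ≡ 1) → Vec.sum (Vec.map ∣_∣ M) ≡ n
size-≡ []      rows = refl
size-≡ (p ∷ M) rows = cong₂ _+_ (rows zero) (size-≡ M (rows ∘ suc))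

length-cartesianProductWith : ∀ {D : Set} (f : A → B → D) xs ys →
                              length (cartesianProductWith f xs ys) ≡ length xs * length ys
length-cartesianProductWith f []       ys = refl
length-cartesianProductWith f (x ∷ xs) ys =
  trans (length-++ (map (f x) ys))
        (cong₂ _+_ (length-map (f x) ys) (length-cartesianProductWith f xs ys))

-- An injective map on pairs yields distinct matchings, all of which occur in `allEdgeSets`. It
-- serves both disjoint unions and complete graphs.
𝓜-≥-* : ∀ (G : BipartiteGraph n) (f : A → B → EdgeSet n) {xs ys} →
        (∀ {w x y z} → f w y ≡ f x z → w ≡ x × y ≡ z) → Unique xs → Unique ys →
        (∀ {x y} → x ∈ xs → y ∈ ys → IsPerfectMatching G (f x y)) →
        length xs * length ys ≤ 𝓜 G
𝓜-≥-* G f {xs} {ys} inj u v perfect =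
  ≤-trans (≤-reflexive (sym (length-cartesianProductWith f xs ys)))
    (Deletion.Unique-⊆⇒length-≤ _≟ᴱ_ (cartesianProductWith⁺ f inj u v) λ {M} M∈ →
      let x , y , x∈ , y∈ , M≡ = ∈-cartesianProductWith⁻ f xs ys M∈ in
      ∈-filter⁺ (isPerfectMatching? G) (allEdgeSets-complete M)
        (subst (IsPerfectMatching G) (sym M≡) (perfect x∈ y∈)))

-- Perfect matchings of a disjoint union

++-⊆ : ∀ {p p′ : Subset m} {q q′ : Subset n} → p ⊆ˢ p′ → q ⊆ˢ q′ → p ++ q ⊆ˢ p′ ++ q′
++-⊆ {p = []}    {[]}     p⊆ q⊆ x∈ = q⊆ x∈
++-⊆ {p = _ ∷ p} {_ ∷ p′} p⊆ q⊆ Vec.here with p⊆ Vec.here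
... | Vec.here = Vec.here
++-⊆ {p = _ ∷ p} {_ ∷ p′} p⊆ q⊆ (Vec.there x∈) = Vec.there (++-⊆ (drop-∷-⊆ p⊆) q⊆ x∈)

-- Built through `⊕`, so that a matching counts as a graph with one neighbour per row and
-- `⊕-leftRegular` yields the row sums of the union.
_⊎ᴱ_ : EdgeSet m → EdgeSet n → EdgeSet (m + n)
M ⊎ᴱ N = edges (graph M ⊕ graph N)

map-++⊥-injective : ∀ {l} (M M′ : Vec (Subset m) l) →
                    Vec.map (_++ ⊥ {n}) M ≡ Vec.map (_++ ⊥) M′ → M ≡ M′
map-++⊥-injective []      []        _  = refl
map-++⊥-injective (p ∷ M) (p′ ∷ M′) eq =
  cong₂ _∷_ (Vec.++-injectiveˡ p p′ (Vec.∷-injectiveˡ eq)) (map-++⊥-injective M M′ (Vec.∷-injectiveʳ eq))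

map-⊥++-injective : ∀ {l} (N N′ : Vec (Subset n) l) →
                    Vec.map (⊥ {m} ++_) N ≡ Vec.map (⊥ ++_) N′ → N ≡ N′
map-⊥++-injective         []      []        _  = refl
map-⊥++-injective {m = m} (p ∷ N) (p′ ∷ N′) eq =
  cong₂ _∷_ (Vec.++-injectiveʳ (⊥ {m}) ⊥ (Vec.∷-injectiveˡ eq))
            (map-⊥++-injective N N′ (Vec.∷-injectiveʳ eq))

⊎ᴱ-injective : ∀ {M M′ : EdgeSet m} {N N′ : EdgeSet n} → M ⊎ᴱ N ≡ M′ ⊎ᴱ N′ → M ≡ M′ × N ≡ N′
⊎ᴱ-injective {m} {n} {M} {M′} {N} {N′} eq =
  let eqˡ , eqʳ = Vec.++-injective (Vec.map (_++ ⊥) M) (Vec.map (_++ ⊥) M′) eq in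
  map-++⊥-injective M M′ eqˡ , map-⊥++-injective N N′ eqʳ

partnersʸ-⊎ᴱˡ : ∀ (M : EdgeSet m) (N : EdgeSet n) y → partnersʸ (M ⊎ᴱ N) (y ↑ˡ n) ≡ partnersʸ M y ++ ⊥
partnersʸ-⊎ᴱˡ {m} {n} M N y = trans (Vec.map-++ _ (Vec.map (_++ ⊥) M) _) (cong₂ _++_
  (trans (sym (Vec.map-∘ _ _ M)) (Vec.map-cong (λ p → Vec.lookup-++ˡ p ⊥ y) M))
  (trans (sym (Vec.map-∘ _ _ N)) (trans
    (Vec.map-cong (λ p → trans (Vec.lookup-++ˡ (⊥ {m}) p y) (Vec.lookup-replicate y outside)) N)
    (Vec.map-const N outside))))

partnersʸ-⊎ᴱʳ : ∀ (M : EdgeSet m) (N : EdgeSet n) y → partnersʸ (M ⊎ᴱ N) (m ↑ʳ y) ≡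
                ⊥ {m} ++ partnersʸ N y
partnersʸ-⊎ᴱʳ {m} {n} M N y = trans (Vec.map-++ _ (Vec.map (_++ ⊥) M) _) (cong₂ _++_
  (trans (sym (Vec.map-∘ _ _ M)) (trans
    (Vec.map-cong (λ p → trans (Vec.lookup-++ʳ p (⊥ {n}) y) (Vec.lookup-replicate y outside)) M)
    (Vec.map-const M outside)))
  (trans (sym (Vec.map-∘ _ _ N)) (Vec.map-cong (λ p → Vec.lookup-++ʳ (⊥ {m}) p y) N)))

⊎ᴱ-perfect : ∀ (G : BipartiteGraph m) (H : BipartiteGraph n) M N →
             IsPerfectMatching G M → IsPerfectMatching H N → IsPerfectMatching (G ⊕ H) (M ⊎ᴱ N)
⊎ᴱ-perfect {m} {n} G H M N (subM , _ , rowsM , colsM) (subN , _ , rowsN , colsN) =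
  sub , size-≡ (M ⊎ᴱ N) rows , rows , λ y → subst Col (join-splitAt m n y) (cols (splitAt m y))
  where
  rows : ∀ x → ∣ partnersˣ (M ⊎ᴱ N) x ∣ ≡ 1
  rows = ⊕-leftRegular (graph M) (graph N) rowsM rowsN
  sub : ∀ x → partnersˣ (M ⊎ᴱ N) x ⊆ˢ neighbours (G ⊕ H) x
  sub x
    rewrite Vec.lookup-splitAt m (Vec.map (_++ ⊥ {n}) (edges G)) (Vec.map (⊥ {m} ++_) (edges H)) x
          | Vec.lookup-splitAt m (Vec.map (_++ ⊥ {n}) M) (Vec.map (⊥ {m} ++_) N) x
    with splitAt m x
  ... | inj₁ i rewrite Vec.lookup-map i (_++ ⊥ {n}) (edges G) | Vec.lookup-map i (_++ ⊥ {n}) M =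
    ++-⊆ (subM i) ⊆-refl
  ... | inj₂ j rewrite Vec.lookup-map j (⊥ {m} ++_) (edges H) | Vec.lookup-map j (⊥ {m} ++_) N =
    ++-⊆ (⊆-refl {x = ⊥ {m}}) (subN j)
  Col : Fin (m + n) → Set
  Col y = ∣ partnersʸ (M ⊎ᴱ N) y ∣ ≡ 1
  cols : ∀ y → Col (join m n y)
  cols (inj₁ y) = trans (cong ∣_∣ (partnersʸ-⊎ᴱˡ M N y)) (trans (∣p++⊥∣≡∣p∣ (partnersʸ M y) n) (colsM y))
  cols (inj₂ y) = trans (cong ∣_∣ (partnersʸ-⊎ᴱʳ M N y)) (trans (∣⊥++p∣≡∣p∣ m (partnersʸ N y)) (colsN y))

𝓜-⊕ : ∀ (G : BipartiteGraph m) (H : BipartiteGraph n) → 𝓜 G * 𝓜 H ≤ 𝓜 (G ⊕ H)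
𝓜-⊕ G H = 𝓜-≥-* (G ⊕ H) _⊎ᴱ_ ⊎ᴱ-injective (matchings-Unique G) (matchings-Unique H)
  λ {M} {N} M∈ N∈ → ⊎ᴱ-perfect G H M N (∈-matchings⁻ G M∈) (∈-matchings⁻ H N∈)

-- Perfect matchings of a complete bipartite graph

∣insertAt-outside∣ : ∀ (p : Subset n) j → ∣ insertAt p j outside ∣ ≡ ∣ p ∣
∣insertAt-outside∣ p             zero    = refl
∣insertAt-outside∣ (inside  ∷ p) (suc j) = cong suc (∣insertAt-outside∣ p j)
∣insertAt-outside∣ (outside ∷ p) (suc j) = ∣insertAt-outside∣ p j

lookup-⁅⁆-punchIn : ∀ (j : Fin (suc n)) y → lookup ⁅ j ⁆ (punchIn j y) ≡ outside
lookup-⁅⁆-punchIn zero    y       = Vec.lookup-replicate y outside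
lookup-⁅⁆-punchIn (suc j) zero    = refl
lookup-⁅⁆-punchIn (suc j) (suc y) = lookup-⁅⁆-punchIn j y

-- Expansion along the first row: the first vertex takes column `j`, and `M` lives on the remaining
-- columns. This is the source of the recursion for `k !`.
extend : Fin (suc n) → EdgeSet n → EdgeSet (suc n)
extend j M = ⁅ j ⁆ ∷ Vec.map (λ p → insertAt p j outside) M

extend-injective : ∀ {i j} {M N : EdgeSet n} → extend i M ≡ extend j N → i ≡ j × M ≡ N
extend-injective {i = i} {M = M} {N} eq with refl ← ⁅⁆-injective (Vec.∷-injectiveˡ eq) =
  refl , insert-injective M N (Vec.∷-injectiveʳ eq)
  where
  insert-injective : ∀ {m} (M N : Vec (Subset _) m) →
    Vec.map (λ p → insertAt p i outside) M ≡ Vec.map (λ p → insertAt p i outside) N → M ≡ N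
  insert-injective []      []      _  = refl
  insert-injective (p ∷ M) (q ∷ N) eq = cong₂ _∷_
    (trans (sym (Vec.removeAt-insertAt p i outside))
      (trans (cong (λ r → Vec.removeAt r i) (Vec.∷-injectiveˡ eq)) (Vec.removeAt-insertAt q i outside)))
    (insert-injective M N (Vec.∷-injectiveʳ eq))

extend-perfect : ∀ j {M : EdgeSet n} → IsPerfectMatching (complete n) M →
                 IsPerfectMatching (complete (suc n)) (extend j M)
extend-perfect {n} j {M} (_ , _ , rowsM , colsM) =
  (λ x {y} _ → subst (y ∈ˢ_) (sym (Vec.lookup-replicate x ⊤)) ∈⊤) ,
  size-≡ (extend j M) rows , rows , cols
  where
  rows : ∀ x → ∣ partnersˣ (extend j M) x ∣ ≡ 1
  rows zero    = ∣⁅x⁆∣≡1 j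
  rows (suc x) = trans (cong ∣_∣ (Vec.lookup-map x _ M))
                       (trans (∣insertAt-outside∣ (lookup M x) j) (rowsM x))
  cols : ∀ y → ∣ partnersʸ (extend j M) y ∣ ≡ 1
  cols y with j Fin.≟ y
  -- Column `j` holds only the new edge, since the inserted entries are `outside`.
  ... | yes refl = trans (cong ∣_∣ (cong₂ _∷_ (Vec.[]=⇒lookup (x∈⁅x⁆ j))
          (trans (sym (Vec.map-∘ _ _ M))
            (trans (Vec.map-cong (λ p → Vec.insertAt-lookup p j outside) M) (Vec.map-const M outside)))))
          (cong suc (∣⊥∣≡0 n))
  -- Any other column is `punchIn j y′`: an `outside` entry on top of column `y′` of `M`.
  ... | no j≢y = subst (λ y → ∣ partnersʸ (extend j M) y ∣ ≡ 1) (punchIn-punchOut j≢y)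
          (trans (cong ∣_∣ (cong₂ _∷_ (lookup-⁅⁆-punchIn j y′)
            (trans (sym (Vec.map-∘ _ _ M))
              (Vec.map-cong (λ p → Vec.insertAt-punchIn p j outside y′) M))))
            (colsM y′))
    where
    y′ : Fin n
    y′ = punchOut j≢y

-- The first vertex has `suc k` possible partners, and each choice extends every perfect matching of
-- the smaller graph.
𝓜-complete : ∀ k → k ! ≤ 𝓜 (complete k)
𝓜-complete zero    = ≤-refl
𝓜-complete (suc k) = begin
  suc k * k !
    ≤⟨ *-monoʳ-≤ (suc k) (𝓜-complete k) ⟩
  suc k * 𝓜 (complete k)
    ≡⟨ cong (_* 𝓜 (complete k)) (length-tabulate {n = suc k} (λ x → x)) ⟨
  length (allFin (suc k)) * 𝓜 (complete k)
    ≤⟨ 𝓜-≥-* (complete (suc k)) extend extend-injective (allFin⁺ (suc k)) (matchings-Unique (complete k))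
         (λ {j} _ M∈ → extend-perfect j (∈-matchings⁻ (complete k) M∈)) ⟩
  𝓜 (complete (suc k)) ∎
  where open ≤-Reasoning

𝓜-copies : ∀ q (G : BipartiteGraph k) → 𝓜 G ^ q ≤ 𝓜 (copies q G)
𝓜-copies zero    G = ≤-refl
𝓜-copies (suc q) G = ≤-trans (*-monoʳ-≤ (𝓜 G) (𝓜-copies q G)) (𝓜-⊕ G (copies q G))

lemma1 : (n k : ℕ) → 1 ≤ n → 1 ≤ k → (k∣n : k ∣ n) →
    (G : BipartiteGraph n) → LeftRegular k G →
    𝓜 G ≤ 𝓜 (disjointCompletes k∣n)
lemma1 _ k _ 1≤k (divides q refl) G reg = begin
  𝓜 G                        ≤⟨ 𝓜-upper q k {{>-nonZero 1≤k}} G reg ⟩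
  (k !) ^ q                  ≤⟨ ^-monoˡ-≤ q (𝓜-complete k) ⟩
  𝓜 (complete k) ^ q         ≤⟨ 𝓜-copies q (complete k) ⟩
  𝓜 (copies q (complete k))  ∎
  where open ≤-Reasoning
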